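{- Let $G$ be a graph. Then $$\chi(G)\le (\dim(G)+1)\cdot \bigl|\log_2(|G|)\bigr|,$$ where $\chi(G)$ is the chromatic number of $G$ (the minimum number of colors needed to color the vertices so that no two adjacent vertices have the same color), $\dim(G)$ is the dimension of $G$ defined in the context, $|G|$ is the number of vertices of $G$, and the outer bars denote absolute value.
   Context: All graphs are finite, simple and undirected; $|G|$ denotes the number of vertices of a graph $G$. For a graph $H$, let $\delta(H)=\max_{x\in V(H)}\deg_H(x)$ denote its maximum degree. For a graph $G'$ define its sub-dimension $$\mathrm{subdim}(G')=\min_{G''}\ \delta(G''),$$ where the minimum is over all induced subgraphs $G''=(V'',E'')$ of $G'$ (i.e. $E''$ consists of all edges of $G'$ with both endpoints in $V''$) with $|V''|\ge \lfloor |G'|/2\rfloor+1$. The dimension of a graph $G$ is $$\dim(G)=\max_{G'}\ \mathrm{subdim}(G'),$$ where the maximum is over all induced subgraphs $G'$ of $G$ (on a nonempty vertex set).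
   Formalization: The graph is assumed to have at least two vertices: for the one-vertex graph the inequality fails (χ = 1, dim = 0, log₂ 1 = 0), and for the empty graph log₂ 0 and the dimension are undefined. -}

module Defs where

open import Data.Empty using (⊥)
open import Data.Fin using (Fin)
open import Data.Fin.Base using (finToFun; funToFin)
open import Data.Fin.Properties using (any?; all?; finToFun-funToFin) renaming (_≟_ to _≟ᶠ_)
open import Data.Fin.Subset using (Subset; inside; outside; _⊆_; _∩_; ∣_∣; Nonempty)
open import Data.Fin.Subset.Properties using (_∈?_; _⊆?_; nonempty?)
open import Data.Integer as ℤ using (ℤ; +_; -[1+_])
import Data.Integer.Properties as ℤP
open import Data.List using (List; []; _∷_; _++_; map; filter; allFin; upTo)
open import Data.List.Extrema.Nat using (min; max)
open import Data.Nat using (ℕ; zero; suc; _+_; _*_; _^_; _≤_; _<_; _>_; NonZero; ⌊_/2⌋; z≤n; s≤s; z<s; s<s; s<s⁻¹; _<?_; _≤?_)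
open import Data.Nat.Properties
open import Data.Nat.Solver using (module +-*-Solver)
open import Data.Product using (∃; _×_; _,_)
open import Data.Rational.Unnormalised as ℚ using (ℚᵘ; mkℚᵘ; *<*; ↥_; ↧_; ↧ₙ_; _≃_)
import Data.Rational.Unnormalised.Properties as ℚP
open import Data.Sum using (_⊎_; inj₁; inj₂; swap)
import Data.Vec as Vec
open import Relation.Binary.PropositionalEquality
open import Relation.Nullary using (¬_; Dec; yes; no; does; contradiction)
open import Relation.Nullary.Decidable using (_→-dec_; _×-dec_; ¬?)
import Relation.Nullary.Decidable as Dec

record Graph (n : ℕ) : Set₁ where
  field
    Adj       : Fin n → Fin n → Set
    adj?      : ∀ x y → Dec (Adj x y)
    symmetric : ∀ {x y} → Adj x y → Adj y x
    irrefl    : ∀ {x} → ¬ Adj x x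

open Graph public

allSubsets : ∀ n → List (Subset n)
allSubsets zero    = Vec.[] ∷ []
allSubsets (suc n) = map (inside Vec.∷_) (allSubsets n) ++ map (outside Vec.∷_) (allSubsets n)

module _ {n : ℕ} (G : Graph n) where

  -- An induced subgraph of G is represented by its vertex set S, so that
  -- deg S x, δ S and subdim S below refer to the graph G[S]; the induced
  -- subgraphs of G[S] are then the G[T] with T ⊆ S.

  neighbours : Fin n → Subset n
  neighbours x = Vec.tabulate (λ y → does (adj? G x y))

  deg : Subset n → Fin n → ℕ
  deg S x = ∣ neighbours x ∩ S ∣

  δ : Subset n → ℕ
  δ S = max 0 (map (deg S) (filter (_∈? S) (allFin n)))

  LargeIn : Subset n → Subset n → Set
  LargeIn S T = T ⊆ S × ⌊ ∣ S ∣ /2⌋ + 1 ≤ ∣ T ∣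

  largeIn? : ∀ S T → Dec (LargeIn S T)
  largeIn? S T = (T ⊆? S) ×-dec (⌊ ∣ S ∣ /2⌋ + 1 ≤? ∣ T ∣)

  -- For nonempty S, T = S is one of the competitors, so the first argument
  -- of min (its value on the empty list) does not affect the result.
  subdim : Subset n → ℕ
  subdim S = min (δ S) (map δ (filter (largeIn? S) (allSubsets n)))

  dim : ℕ
  dim = max 0 (map subdim (filter nonempty? (allSubsets n)))

  Proper : ∀ {k} → (Fin n → Fin k) → Set
  Proper c = ∀ x y → Adj G x y → c x ≢ c y

  Colourable : ℕ → Set
  Colourable k = ∃ λ (c : Fin n → Fin k) → Proper c

  proper? : ∀ {k} (c : Fin n → Fin k) → Dec (Proper c)
  proper? c = all? λ x → all? λ y → adj? G x y →-dec ¬? (c x ≟ᶠ c y)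

  colourable? : ∀ k → Dec (Colourable k)
  colourable? k = Dec.map′
    (λ (i , p) → finToFun i , p)
    (λ (c , p) → funToFin c , λ x y a e → p x y a
      (trans (sym (finToFun-funToFin c x)) (trans e (finToFun-funToFin c y))))
    (any? λ (i : Fin (k ^ n)) → proper? (finToFun i))

  -- n colours always suffice, so only k < n need to be searched.
  χ : ℕ
  χ = min n (filter colourable? (upTo n))

-- Real numbers, as two-sided Dedekind cuts of ℚ

record ℝ : Set₁ where
  field
    L U         : ℚᵘ → Set
    L-inhabited : ∃ L
    U-inhabited : ∃ U
    L-lower     : ∀ {p q} → p ℚ.< q → L q → L p
    U-upper     : ∀ {p q} → p ℚ.< q → U p → U q
    L-open      : ∀ {p} → L p → ∃ λ q → p ℚ.< q × L q
    U-open      : ∀ {q} → U q → ∃ λ p → p ℚ.< q × U p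
    disjoint    : ∀ {q} → L q → U q → ⊥
    located     : ∀ {p q} → p ℚ.< q → L p ⊎ U q

open ℝ public

module _ (x : ℝ) where

  L-resp : ∀ {p q} → p ≃ q → L x p → L x q
  L-resp p≃q Lp with L-open x Lp
  ... | r , p<r , Lr = L-lower x (ℚP.<-respˡ-≃ p≃q p<r) Lr

  U-resp : ∀ {p q} → p ≃ q → U x p → U x q
  U-resp p≃q Up with U-open x Up
  ... | r , r<p , Ur = U-upper x (ℚP.<-respʳ-≃ p≃q r<p) Ur

infix 4 _≤ℝ_
_≤ℝ_ : ℝ → ℝ → Set
x ≤ℝ y = ∀ q → L x q → L y q

fromℚ : ℚᵘ → ℝ
fromℚ r = record
  { L = ℚ._< r
  ; U = r ℚ.<_
  ; L-inhabited = r ℚ.- ℚ.1ℚᵘ ,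
      ℚP.<-respʳ-≃ (ℚP.+-identityʳ r) (ℚP.+-monoʳ-< r {ℚ.- ℚ.1ℚᵘ} {ℚ.0ℚᵘ} (*<* ℤ.-<+))
  ; U-inhabited = r ℚ.+ ℚ.1ℚᵘ ,
      ℚP.<-respˡ-≃ (ℚP.+-identityʳ r) (ℚP.+-monoʳ-< r {ℚ.0ℚᵘ} {ℚ.1ℚᵘ} (*<* (ℤ.+<+ z<s)))
  ; L-lower = ℚP.<-trans
  ; U-upper = λ p<q r<p → ℚP.<-trans r<p p<q
  ; L-open = ℚP.<-dense
  ; U-open = λ r<q → let (m , r<m , m<q) = ℚP.<-dense r<q in m , m<q , r<m
  ; disjoint = λ q<r r<q → ℚP.<-asym q<r r<q
  ; located = loc
  }
  where
  loc : ∀ {p q} → p ℚ.< q → p ℚ.< r ⊎ r ℚ.< q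
  loc {p} p<q with p ℚP.<? r
  ... | yes p<r = inj₁ p<r
  ... | no  p≮r = inj₂ (ℚP.≤-<-trans (ℚP.≮⇒≥ p≮r) p<q)

fromℕ : ℕ → ℝ
fromℕ k = fromℚ (+ k ℚ./ 1)

infix 8 -ℝ_
-ℝ_ : ℝ → ℝ
-ℝ x = record
  { L = λ q → U x (ℚ.- q)
  ; U = λ q → L x (ℚ.- q)
  ; L-inhabited = let (q , Uq) = U-inhabited x in ℚ.- q , U-resp x (neg² q) Uq
  ; U-inhabited = let (q , Lq) = L-inhabited x in ℚ.- q , L-resp x (neg² q) Lq
  ; L-lower = λ p<q → U-upper x (ℚP.neg-mono-< p<q)
  ; U-upper = λ p<q → L-lower x (ℚP.neg-mono-< p<q)
  ; L-open = λ {p} Up → let (r , r<-p , Ur) = U-open x Up in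
      ℚ.- r , ℚP.<-respˡ-≃ (ℚP.≃-sym (neg² p)) (ℚP.neg-mono-< r<-p) , U-resp x (neg² r) Ur
  ; U-open = λ {q} Lq → let (r , -q<r , Lr) = L-open x Lq in
      ℚ.- r , ℚP.<-respʳ-≃ (ℚP.≃-sym (neg² q)) (ℚP.neg-mono-< -q<r) , L-resp x (neg² r) Lr
  ; disjoint = λ Uq Lq → disjoint x Lq Uq
  ; located = λ p<q → swap (located x (ℚP.neg-mono-< p<q))
  }
  where
  neg² : ∀ q → q ≃ ℚ.- (ℚ.- q)
  neg² q = ℚP.≃-sym (ℚP.neg-involutive q)

infixl 6 _⊔ℝ_
_⊔ℝ_ : ℝ → ℝ → ℝ
x ⊔ℝ y = record
  { L = λ q → L x q ⊎ L y q
  ; U = λ q → U x q × U y q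
  ; L-inhabited = let (q , Lq) = L-inhabited x in q , inj₁ Lq
  ; U-inhabited = U-inh
  ; L-lower = λ { p<q (inj₁ l) → inj₁ (L-lower x p<q l) ; p<q (inj₂ l) → inj₂ (L-lower y p<q l) }
  ; U-upper = λ p<q (u , v) → U-upper x p<q u , U-upper y p<q v
  ; L-open = λ { (inj₁ l) → let (r , a , b) = L-open x l in r , a , inj₁ b
               ; (inj₂ l) → let (r , a , b) = L-open y l in r , a , inj₂ b }
  ; U-open = U-op
  ; disjoint = λ { (inj₁ l) (u , _) → disjoint x l u ; (inj₂ l) (_ , v) → disjoint y l v }
  ; located = loc
  }
  where
  U-weak : ∀ z {p q} → p ℚ.≤ q → U z p → U z q
  U-weak z p≤q Up = let (r , r<p , Ur) = U-open z Up in U-upper z (ℚP.<-≤-trans r<p p≤q) Ur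
  both : ∀ {p q} → U x p → U y q → U x (p ℚ.⊔ q) × U y (p ℚ.⊔ q)
  both {p} {q} u v = U-weak x (ℚP.p≤p⊔q p q) u , U-weak y (ℚP.p≤q⊔p p q) v
  U-inh : ∃ λ q → U x q × U y q
  U-inh = let (p , u) = U-inhabited x ; (q , v) = U-inhabited y in p ℚ.⊔ q , both u v
  U-op : ∀ {q} → U x q × U y q → ∃ λ p → p ℚ.< q × (U x p × U y p)
  U-op {q} (u , v) = let (a , a<q , ua) = U-open x u ; (b , b<q , vb) = U-open y v in
    a ℚ.⊔ b , lub a b a<q b<q , both ua vb
    where
    lub : ∀ a b → a ℚ.< q → b ℚ.< q → a ℚ.⊔ b ℚ.< q
    lub a b a<q b<q with ℚP.⊔-sel a b
    ... | inj₁ e = ℚP.<-respˡ-≃ (ℚP.≃-sym e) a<q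
    ... | inj₂ e = ℚP.<-respˡ-≃ (ℚP.≃-sym e) b<q
  loc : ∀ {p q} → p ℚ.< q → (L x p ⊎ L y p) ⊎ (U x q × U y q)
  loc p<q with located x p<q | located y p<q
  ... | inj₁ l | _      = inj₁ (inj₁ l)
  ... | inj₂ _ | inj₁ l = inj₁ (inj₂ l)
  ... | inj₂ u | inj₂ v = inj₂ (u , v)

∣_∣ℝ : ℝ → ℝ
∣ x ∣ℝ = x ⊔ℝ (-ℝ x)

-- k · x for a positive natural number k:  q < k · x  iff  q / k < x.
infixl 7 _·_
_·_ : (k : ℕ) .{{_ : NonZero k}} → ℝ → ℝ
k@(suc _) · x = record
  { L = λ q → L x (q ℚ.* 1/k)
  ; U = λ q → U x (q ℚ.* 1/k)
  ; L-inhabited = let (q , l) = L-inhabited x in q ℚ.* k/1 , L-resp x (ℚP.≃-sym (cancel q)) l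
  ; U-inhabited = let (q , u) = U-inhabited x in q ℚ.* k/1 , U-resp x (ℚP.≃-sym (cancel q)) u
  ; L-lower = λ p<q → L-lower x (ℚP.*-monoˡ-<-pos 1/k p<q)
  ; U-upper = λ p<q → U-upper x (ℚP.*-monoˡ-<-pos 1/k p<q)
  ; L-open = λ {p} l → let (r , a , b) = L-open x l in
      r ℚ.* k/1 , ℚP.<-respˡ-≃ (cancel′ p) (ℚP.*-monoˡ-<-pos k/1 a) , L-resp x (ℚP.≃-sym (cancel r)) b
  ; U-open = λ {q} u → let (r , a , b) = U-open x u in
      r ℚ.* k/1 , ℚP.<-respʳ-≃ (cancel′ q) (ℚP.*-monoˡ-<-pos k/1 a) , U-resp x (ℚP.≃-sym (cancel r)) b
  ; disjoint = disjoint x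
  ; located = λ p<q → located x (ℚP.*-monoˡ-<-pos 1/k p<q)
  }
  where
  k/1 1/k : ℚᵘ
  k/1 = + k ℚ./ 1
  1/k = + 1 ℚ./ k
  cancel : ∀ q → (q ℚ.* k/1) ℚ.* 1/k ≃ q
  cancel q = ℚP.≃-trans (ℚP.*-assoc q k/1 1/k)
    (ℚP.≃-trans (ℚP.*-congˡ {q} (ℚP.*-inverseʳ k/1)) (ℚP.*-identityʳ q))
  cancel′ : ∀ q → (q ℚ.* 1/k) ℚ.* k/1 ≃ q
  cancel′ q = ℚP.≃-trans (ℚP.*-assoc q 1/k k/1)
    (ℚP.≃-trans (ℚP.*-congˡ {q} (ℚP.*-inverseˡ k/1)) (ℚP.*-identityʳ q))

_⁺ _⁻ : ℤ → ℕ
(+ p)    ⁺ = p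
-[1+ p ] ⁺ = 0
(+ p)    ⁻ = 0
-[1+ p ] ⁻ = suc p

^-distribʳ-* : ∀ a b k → (a * b) ^ k ≡ a ^ k * b ^ k
^-distribʳ-* a b zero    = refl
^-distribʳ-* a b (suc k) rewrite ^-distribʳ-* a b k =
  solve 4 (λ a b x y → (a :* b) :* (x :* y) := (a :* x) :* (b :* y)) refl a b (a ^ k) (b ^ k)
  where open +-*-Solver

^-cancelˡ-< : ∀ k {a b} → a ^ k < b ^ k → a < b
^-cancelˡ-< k {a} {b} lt with a <? b
... | yes a<b = a<b
... | no  a≮b = contradiction lt (≤⇒≯ (^-monoˡ-≤ k (≮⇒≥ a≮b)))

-- Bernoulli's inequality, multiplied by a: (1 + 1/a) ^ k ≥ 1 + k/a.
bernoulli : ∀ a k → a ^ suc k + k * a ^ k ≤ a * suc a ^ k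
bernoulli a zero    = ≤-reflexive (solve 1 (λ a → a :* con 1 :+ con 0 := a :* con 1) refl a)
  where open +-*-Solver
bernoulli a (suc k) = begin
  a * (a * a ^ k) + (1 + k) * (a * a ^ k)                 ≤⟨ m≤m+n _ (k * a ^ k) ⟩
  a * (a * a ^ k) + (1 + k) * (a * a ^ k) + k * a ^ k     ≡⟨ solve 3 (λ a k x →
      a :* (a :* x) :+ (con 1 :+ k) :* (a :* x) :+ k :* x := (con 1 :+ a) :* (a :* x :+ k :* x)) refl a k (a ^ k) ⟩
  suc a * (a ^ suc k + k * a ^ k)                         ≤⟨ *-monoʳ-≤ (suc a) (bernoulli a k) ⟩
  suc a * (a * suc a ^ k)                                 ≡⟨ solve 2 (λ a y →
      (con 1 :+ a) :* (a :* y) := a :* ((con 1 :+ a) :* y)) refl a (suc a ^ k) ⟩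
  a * suc a ^ suc k                                       ∎
  where open ≤-Reasoning; open +-*-Solver

double-gap : ∀ {a b} .{{_ : NonZero a}} → a < b → 2 * a ^ suc a < b ^ suc a
double-gap {a} a<b = <-≤-trans (*-cancelˡ-< a _ _ gap) (^-monoˡ-≤ (suc a) a<b)
  where
  open ≤-Reasoning
  open +-*-Solver
  gap : a * (2 * a ^ suc a) < a * suc a ^ suc a
  gap = begin-strict
    a * (2 * a ^ suc a)                 ≡⟨ solve 2 (λ a x → a :* (con 2 :* x) := a :* x :+ a :* x) refl a (a ^ suc a) ⟩
    a ^ suc (suc a) + a * a ^ suc a     <⟨ +-monoʳ-< (a ^ suc (suc a)) (*-monoˡ-< (a ^ suc a) {{m^n≢0 a (suc a)}} (n<1+n a)) ⟩
    a ^ suc (suc a) + suc a * a ^ suc a ≤⟨ bernoulli a (suc a) ⟩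
    a * suc a ^ suc a                   ∎

-- For q = a / d, the comparison of 2 ^ q with n is the comparison of 2 ^ a
-- with n ^ d; a negative a = a⁺ - a⁻ is moved to the other side.
module Log₂ (n : ℕ) .{{n≢0 : NonZero n}} where

  lhs rhs : ℚᵘ → ℕ
  lhs q = 2 ^ (↥ q) ⁺
  rhs q = n ^ ↧ₙ q * 2 ^ (↥ q) ⁻

  2^_<n 2^_>n : ℚᵘ → Set
  2^ q <n = lhs q < rhs q
  2^ q >n = lhs q > rhs q

  cross-exp : ∀ {p q} → p ℚ.< q →
    (↥ p) ⁺ * ↧ₙ q + (↥ q) ⁻ * ↧ₙ p < (↥ q) ⁺ * ↧ₙ p + (↥ p) ⁻ * ↧ₙ q
  cross-exp {mkℚᵘ (+ a) d} {mkℚᵘ (+ b) e} (*<* lt) =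
    subst₂ _<_ (sym (+-identityʳ _)) (sym (+-identityʳ _))
      (ℤP.drop‿+<+ (subst₂ ℤ._<_ (sym (ℤP.pos-* a (suc e))) (sym (ℤP.pos-* b (suc d))) lt))
  cross-exp {mkℚᵘ (+ zero) d} {mkℚᵘ -[1+ b ] e} (*<* ())
  cross-exp {mkℚᵘ (+ suc a) d} {mkℚᵘ -[1+ b ] e} (*<* ())
  cross-exp {mkℚᵘ -[1+ a ] d} {mkℚᵘ (+ b) e} (*<* lt) =
    <-≤-trans z<s (m≤n+m _ (b * suc d))
  cross-exp {mkℚᵘ -[1+ a ] d} {mkℚᵘ -[1+ b ] e} (*<* (ℤ.-<- lt)) = s<s lt

  cross : ∀ {p q} → p ℚ.< q →
    lhs p ^ ↧ₙ q * rhs q ^ ↧ₙ p < lhs q ^ ↧ₙ p * rhs p ^ ↧ₙ q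
  cross {p} {q} p<q = begin-strict
    lhs p ^ ↧ₙ q * rhs q ^ ↧ₙ p
      ≡⟨ expand ((↥ p) ⁺) (↧ₙ q) (↧ₙ q) ((↥ q) ⁻) (↧ₙ p) ⟩
    n ^ (↧ₙ q * ↧ₙ p) * 2 ^ ((↥ p) ⁺ * ↧ₙ q + (↥ q) ⁻ * ↧ₙ p)
      <⟨ *-monoʳ-< (n ^ (↧ₙ q * ↧ₙ p)) {{m^n≢0 n (↧ₙ q * ↧ₙ p)}} (^-monoʳ-< 2 (s<s z<s) (cross-exp p<q)) ⟩
    n ^ (↧ₙ q * ↧ₙ p) * 2 ^ ((↥ q) ⁺ * ↧ₙ p + (↥ p) ⁻ * ↧ₙ q)
      ≡⟨ cong (λ m → n ^ m * 2 ^ ((↥ q) ⁺ * ↧ₙ p + (↥ p) ⁻ * ↧ₙ q)) (*-comm (↧ₙ q) (↧ₙ p)) ⟩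
    n ^ (↧ₙ p * ↧ₙ q) * 2 ^ ((↥ q) ⁺ * ↧ₙ p + (↥ p) ⁻ * ↧ₙ q)
      ≡⟨ expand ((↥ q) ⁺) (↧ₙ p) (↧ₙ p) ((↥ p) ⁻) (↧ₙ q) ⟨
    lhs q ^ ↧ₙ p * rhs p ^ ↧ₙ q ∎
    where
    open ≤-Reasoning
    expand : ∀ a d e b f → (2 ^ a) ^ d * (n ^ e * 2 ^ b) ^ f ≡ n ^ (e * f) * 2 ^ (a * d + b * f)
    expand a d e b f = trans
      (cong₂ _*_ (^-*-assoc 2 a d) (trans (^-distribʳ-* (n ^ e) (2 ^ b) f) (cong₂ _*_ (^-*-assoc n e f) (^-*-assoc 2 b f))))
      (trans (solve 3 (λ x y z → x :* (y :* z) := y :* (x :* z)) refl (2 ^ (a * d)) (n ^ (e * f)) (2 ^ (b * f)))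
        (cong (n ^ (e * f) *_) (sym (^-distribˡ-+-* 2 (a * d) (b * f)))))
      where open +-*-Solver

  lower : ∀ {p q} → p ℚ.< q → 2^ q <n → 2^ p <n
  lower {p} {q} p<q lt = ^-cancelˡ-< (↧ₙ q) (*-cancelʳ-< (rhs q ^ ↧ₙ p) _ _
    (<-≤-trans (cross p<q)
      (≤-trans (*-monoˡ-≤ _ (^-monoˡ-≤ (↧ₙ p) (<⇒≤ lt)))
               (≤-reflexive (*-comm (rhs q ^ ↧ₙ p) _)))))

  upper : ∀ {p q} → p ℚ.< q → rhs p ≤ lhs p → 2^ q >n
  upper {p} {q} p<q le = ^-cancelˡ-< (↧ₙ p) (*-cancelʳ-< (lhs p ^ ↧ₙ q) _ _
    (<-≤-trans (≤-<-trans (≤-reflexive (*-comm (rhs q ^ ↧ₙ p) _)) (cross p<q))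
      (*-monoʳ-≤ (lhs q ^ ↧ₙ p) (^-monoˡ-≤ (↧ₙ q) le))))

  n<2^n : ∀ m → m < 2 ^ m
  n<2^n zero    = z<s
  n<2^n (suc m) = ≤-trans (+-mono-≤ (m^n>0 2 m) (n<2^n m)) (≤-reflexive (cong (λ z → 2 ^ m + z) (sym (+-identityʳ _))))

  neg-lower : ∀ a d → 2^ mkℚᵘ -[1+ a ] d <n
  neg-lower a d = *-mono-≤ (m^n>0 n (suc d)) (^-monoʳ-≤ 2 {1} {suc a} (s≤s z≤n))

  open-L : ∀ {p} → 2^ p <n → ∃ λ q → p ℚ.< q × 2^ q <n
  open-L {mkℚᵘ (+ a) d} lt = mkℚᵘ (+ suc (a * k)) (d + c * suc d) ,
      *<* (subst₂ ℤ._<_ (ℤP.pos-* a (k * suc d)) (ℤP.pos-* (suc (a * k)) (suc d)) (ℤ.+<+ less)) ,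
      subst₂ _<_ eqL eqR (double-gap {{m^n≢0 2 a}} lt′)
    where
    c = 2 ^ a
    k = suc c
    lt′ : 2 ^ a < n ^ suc d
    lt′ = subst (2 ^ a <_) (*-identityʳ _) lt
    less : a * (k * suc d) < suc (a * k) * suc d
    less = subst (_< suc (a * k) * suc d) (*-assoc a k (suc d)) (*-monoˡ-< (suc d) (n<1+n (a * k)))
    eqL : 2 * (2 ^ a) ^ k ≡ 2 ^ suc (a * k)
    eqL = cong (2 *_) (^-*-assoc 2 a k)
    eqR : (n ^ suc d) ^ k ≡ n ^ (k * suc d) * 1
    eqR = trans (^-*-assoc n (suc d) k) (trans (cong (n ^_) (*-comm (suc d) k)) (sym (*-identityʳ _)))
  open-L {mkℚᵘ -[1+ a ] d} lt = mkℚᵘ -[1+ a + a ] (d + suc d) ,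
      *<* (ℤ.-<- (s<s⁻¹ less)) , neg-lower (a + a) (d + suc d)
    where
    less : suc (a + a) * suc d < suc a * (suc d + suc d)
    less = subst (suc (a + a) * suc d <_)
      (solve 2 (λ a D → (con 2 :+ (a :+ a)) :* D := (con 1 :+ a) :* (D :+ D)) refl a (suc d))
      (*-monoˡ-< (suc d) (n<1+n (suc (a + a))))
      where open +-*-Solver

  open-U : ∀ {q} → 2^ q >n → ∃ λ p → p ℚ.< q × 2^ p >n
  open-U {mkℚᵘ (+ zero) d} lt = contradiction lt (≤⇒≯ (≤-trans (m^n>0 n (suc d)) (≤-reflexive (sym (*-identityʳ _)))))
  open-U {mkℚᵘ (+ suc a) d} lt = mkℚᵘ (+ (a + c * suc a)) (d + c * suc d) ,
      *<* (subst₂ ℤ._<_ (ℤP.pos-* (a + c * suc a) (suc d)) (ℤP.pos-* (suc a) (k * suc d)) (ℤ.+<+ less)) ,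
      *-cancelˡ-< 2 _ _ (subst₂ _<_ eqL eqR (double-gap {{m^n≢0 n (suc d)}} lt′))
    where
    c = n ^ suc d
    k = suc c
    lt′ : n ^ suc d < 2 ^ suc a
    lt′ = subst (_< 2 ^ suc a) (*-identityʳ _) lt
    less : (a + c * suc a) * suc d < suc a * (k * suc d)
    less = subst ((a + c * suc a) * suc d <_)
      (trans (cong (_* suc d) (*-comm k (suc a))) (*-assoc (suc a) k (suc d)))
      (*-monoˡ-< (suc d) (n<1+n (a + c * suc a)))
    eqL : 2 * (n ^ suc d) ^ k ≡ 2 * (n ^ (k * suc d) * 1)
    eqL = cong (2 *_) (trans (^-*-assoc n (suc d) k)
      (trans (cong (n ^_) (*-comm (suc d) k)) (sym (*-identityʳ _))))
    eqR : (2 ^ suc a) ^ k ≡ 2 * 2 ^ (a + c * suc a)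
    eqR = trans (^-*-assoc 2 (suc a) k) (cong (2 ^_) (*-comm (suc a) k))
  open-U {mkℚᵘ -[1+ a ] d} lt = contradiction lt (<-asym (neg-lower a d))

log₂ : (n : ℕ) .{{_ : NonZero n}} → ℝ
log₂ n = record
  { L = 2^_<n
  ; U = 2^_>n
  ; L-inhabited = mkℚᵘ -[1+ 0 ] 0 , neg-lower 0 0
  ; U-inhabited = mkℚᵘ (+ n) 0 ,
      subst (_< 2 ^ n) (sym (trans (*-identityʳ _) (*-identityʳ n))) (n<2^n n)
  ; L-lower = lower
  ; U-upper = λ p<q u → upper p<q (<⇒≤ u)
  ; L-open = open-L
  ; U-open = open-U
  ; disjoint = <-asym
  ; located = loc
  }
  where
  open Log₂ n
  loc : ∀ {p q} → p ℚ.< q → 2^ p <n ⊎ 2^ q >n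
  loc {p} p<q with lhs p <? rhs p
  ... | yes l = inj₁ l
  ... | no  l = inj₂ (upper p<q (≮⇒≥ l))

{-# OPTIONS --safe #-}

-- Put D = dim G + 1 and suppose G has an edge, so D ≥ 2.  Every nonempty vertex
-- set S contains a T with more than |S|/2 vertices and maximum degree < D; a greedy
-- colouring of T uses D colours, and S ∖ T, of size r with 2 r + 1 ≤ |S|, is coloured
-- with fresh colours by recursion.  The naive count of 1 + log₂ r ≤ log₂ |S| rounds
-- breaks down only at r = 1, where a single further colour is enough instead
-- of D of them: D + 1 ≤ D log₂ 3 because D ≥ 2.

module Submission where

open import Defs
open import Data.Fin using (Fin; zero; suc; toℕ; fromℕ<)
open import Data.Fin.Properties using (toℕ<n; toℕ-injective; fromℕ<-injective) renaming (_≟_ to _≟ᶠ_)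
open import Data.Fin.Subset
  using (Subset; inside; outside; _∈_; _⊆_; _∩_; _∪_; _─_; ∁; ⊤; ⊥; ⁅_⁆; ∣_∣; Nonempty)
open import Data.Fin.Subset.Properties
open import Data.Integer as ℤ using (+_)
import Data.Integer.Properties as ℤP
open import Data.List using ([]; _∷_; map; filter; allFin; upTo)
open import Data.List.Extrema.Nat using (argmin-sel; min≤v⁺; min≤⊤; xs≤max)
open import Data.List.Membership.Propositional using (lose) renaming (_∈_ to _∈ₗ_)
open import Data.List.Membership.Propositional.Properties
  using (∈-map⁺; ∈-map⁻; ∈-filter⁺; ∈-filter⁻; ∈-allFin; ∈-upTo⁺; ∈-++⁺ˡ; ∈-++⁺ʳ)
import Data.List.Relation.Unary.All as All
open import Data.List.Relation.Unary.Any using (here; there)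
open import Data.Nat using (ℕ; zero; suc; NonZero; _+_; _*_; _^_; _≤_; _<_; ⌊_/2⌋; ⌈_/2⌉; z≤n; s≤s; _<?_; _≤?_)
open import Data.Nat.Induction using (<-rec)
open import Data.Nat.Properties
open import Data.Product using (∃; _×_; _,_; proj₁; proj₂)
open import Data.Rational.Unnormalised as ℚ using (mkℚᵘ; *≡*)
import Data.Rational.Unnormalised.Properties as ℚP
open import Data.Sum using (inj₁; inj₂)
import Data.Vec as Vec
open import Data.Vec.Properties using (lookup∘tabulate; lookup⇒[]=)
open import Function using (id; _∘_)
open import Relation.Binary.PropositionalEquality
open import Relation.Nullary using (yes; no; contradiction)
open import Relation.Nullary.Decidable using (dec-true)

-- Cardinalities of finite subsets, and two arithmetic bounds.

∣p∪q∣≤∣p∣+∣q∣ : ∀ {n} (p q : Subset n) → ∣ p ∪ q ∣ ≤ ∣ p ∣ + ∣ q ∣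
∣p∪q∣≤∣p∣+∣q∣ Vec.[]              Vec.[]              = z≤n
∣p∪q∣≤∣p∣+∣q∣ (outside Vec.∷ p) (outside Vec.∷ q) = ∣p∪q∣≤∣p∣+∣q∣ p q
∣p∪q∣≤∣p∣+∣q∣ (outside Vec.∷ p) (inside  Vec.∷ q) =
  ≤-trans (s≤s (∣p∪q∣≤∣p∣+∣q∣ p q)) (≤-reflexive (sym (+-suc ∣ p ∣ ∣ q ∣)))
∣p∪q∣≤∣p∣+∣q∣ (inside  Vec.∷ p) (outside Vec.∷ q) = s≤s (∣p∪q∣≤∣p∣+∣q∣ p q)
∣p∪q∣≤∣p∣+∣q∣ (inside  Vec.∷ p) (inside  Vec.∷ q) =
  s≤s (≤-trans (∣p∪q∣≤∣p∣+∣q∣ p q) (+-monoʳ-≤ ∣ p ∣ (n≤1+n ∣ q ∣)))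

q⊆p⇒∣q∣+∣p─q∣≤∣p∣ : ∀ {n} (p q : Subset n) → q ⊆ p → ∣ q ∣ + ∣ p ─ q ∣ ≤ ∣ p ∣
q⊆p⇒∣q∣+∣p─q∣≤∣p∣ Vec.[]            Vec.[]            q⊆p = z≤n
q⊆p⇒∣q∣+∣p─q∣≤∣p∣ (outside Vec.∷ p) (outside Vec.∷ q) q⊆p = q⊆p⇒∣q∣+∣p─q∣≤∣p∣ p q (drop-∷-⊆ q⊆p)
q⊆p⇒∣q∣+∣p─q∣≤∣p∣ (outside Vec.∷ p) (inside  Vec.∷ q) q⊆p = contradiction (q⊆p Vec.here) λ ()
q⊆p⇒∣q∣+∣p─q∣≤∣p∣ (inside  Vec.∷ p) (outside Vec.∷ q) q⊆p =
  ≤-trans (≤-reflexive (+-suc ∣ q ∣ ∣ p ─ q ∣)) (s≤s (q⊆p⇒∣q∣+∣p─q∣≤∣p∣ p q (drop-∷-⊆ q⊆p)))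
q⊆p⇒∣q∣+∣p─q∣≤∣p∣ (inside  Vec.∷ p) (inside  Vec.∷ q) q⊆p = s≤s (q⊆p⇒∣q∣+∣p─q∣≤∣p∣ p q (drop-∷-⊆ q⊆p))

x∈p⇒0<∣p∣ : ∀ {n} {p : Subset n} {x} → x ∈ p → 0 < ∣ p ∣
x∈p⇒0<∣p∣ x∈p = ≤-<-trans z≤n (x∈p⇒∣p-x∣<∣p∣ x∈p)

0<∣p∣⇒nonempty : ∀ {n} {p : Subset n} → 0 < ∣ p ∣ → Nonempty p
0<∣p∣⇒nonempty {p = inside  Vec.∷ p} _  = zero , Vec.here
0<∣p∣⇒nonempty {p = outside Vec.∷ p} lt = let (x , x∈p) = 0<∣p∣⇒nonempty lt in suc x , Vec.there x∈p

x≢y⇒2≤∣p∣ : ∀ {n} {p : Subset n} {x y} → x ∈ p → y ∈ p → x ≢ y → 2 ≤ ∣ p ∣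
x≢y⇒2≤∣p∣ x∈p y∈p x≢y = ≤-trans (s≤s (x∈p⇒0<∣p∣ (x∈p∧x≢y⇒x∈p-y x∈p x≢y))) (x∈p⇒∣p-x∣<∣p∣ y∈p)

image : ∀ {n k} → (Fin n → Fin k) → Subset n → Subset k
image c Vec.[]              = ⊥
image c (inside  Vec.∷ p) = ⁅ c zero ⁆ ∪ image (c ∘ suc) p
image c (outside Vec.∷ p) = image (c ∘ suc) p

∈-image : ∀ {n k} (c : Fin n → Fin k) {p x} → x ∈ p → c x ∈ image c p
∈-image c {inside  Vec.∷ p} Vec.here        = p⊆p∪q _ (x∈⁅x⁆ (c zero))
∈-image c {inside  Vec.∷ p} (Vec.there x∈p) = q⊆p∪q ⁅ c zero ⁆ _ (∈-image (c ∘ suc) x∈p)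
∈-image c {outside Vec.∷ p} (Vec.there x∈p) = ∈-image (c ∘ suc) x∈p

∣image∣≤∣p∣ : ∀ {n k} (c : Fin n → Fin k) p → ∣ image c p ∣ ≤ ∣ p ∣
∣image∣≤∣p∣ {k = k} c Vec.[] = ≤-reflexive (∣⊥∣≡0 k)
∣image∣≤∣p∣ c (inside  Vec.∷ p) =
  ≤-trans (∣p∪q∣≤∣p∣+∣q∣ ⁅ c zero ⁆ _)
          (+-mono-≤ (≤-reflexive (∣⁅x⁆∣≡1 (c zero))) (∣image∣≤∣p∣ (c ∘ suc) p))
∣image∣≤∣p∣ c (outside Vec.∷ p) = ∣image∣≤∣p∣ (c ∘ suc) p

-- Pigeonhole: the image has at most `∣ p ∣ < k` elements, so its complement contains a colour.
avoid-image : ∀ {n k} (c : Fin n → Fin k) p → ∣ p ∣ < k → ∃ λ j → ∀ {x} → x ∈ p → c x ≢ j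
avoid-image {k = k} c p ∣p∣<k with nonempty? (∁ (image c p))
... | yes (j , j∈∁) = j , λ { x∈p refl → x∈∁p⇒x∉p j∈∁ (∈-image c x∈p) }
... | no  none = contradiction ∣p∣<k (≤⇒≯ (begin
  k              ≡⟨ ∣⊤∣≡n k ⟨
  ∣ ⊤ {k} ∣      ≤⟨ p⊆q⇒∣p∣≤∣q∣ {p = ⊤} {q = image c p} (λ {x} _ → x∉∁p⇒x∈p (λ x∈∁ → none (x , x∈∁))) ⟩
  ∣ image c p ∣  ≤⟨ ∣image∣≤∣p∣ c p ⟩
  ∣ p ∣          ∎))
  where open ≤-Reasoning

∈-allSubsets : ∀ {n} (p : Subset n) → p ∈ₗ allSubsets n
∈-allSubsets Vec.[]            = here refl
∈-allSubsets (inside  Vec.∷ p) = ∈-++⁺ˡ (∈-map⁺ (inside Vec.∷_) (∈-allSubsets p))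
∈-allSubsets (outside Vec.∷ p) = ∈-++⁺ʳ _ (∈-map⁺ (outside Vec.∷_) (∈-allSubsets p))

-- Comparing `t + r` with `⌊ m /2⌋ + ⌈ m /2⌉` gives `r < ⌈ m /2⌉`, hence also `r ≤ ⌊ m /2⌋`. Adding
-- the two keeps the strictness, so that a rest of one vertex forces a whole of at least 3.
2·rest<whole : ∀ {m t r} → ⌊ m /2⌋ + 1 ≤ t → t + r ≤ m → 1 + 2 * r ≤ m
2·rest<whole {m} {t} {r} large t+r≤m = begin
  1 + 2 * r              ≡⟨ cong (λ s → suc (r + s)) (+-identityʳ r) ⟩
  suc (r + r)            ≡⟨ +-suc r r ⟨
  r + suc r              ≤⟨ +-mono-≤ r≤⌊⌋ r<⌈⌉ ⟩
  ⌊ m /2⌋ + ⌈ m /2⌉      ≡⟨ ⌊n/2⌋+⌈n/2⌉≡n m ⟩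
  m                      ∎
  where
  open ≤-Reasoning
  r<⌈⌉ : suc r ≤ ⌈ m /2⌉
  r<⌈⌉ = +-cancelˡ-≤ ⌊ m /2⌋ _ _ (begin
    ⌊ m /2⌋ + suc r      ≡⟨ +-assoc ⌊ m /2⌋ 1 r ⟨
    ⌊ m /2⌋ + 1 + r      ≤⟨ +-monoˡ-≤ r large ⟩
    t + r                ≤⟨ t+r≤m ⟩
    m                    ≡⟨ ⌊n/2⌋+⌈n/2⌉≡n m ⟨
    ⌊ m /2⌋ + ⌈ m /2⌉    ∎)
  r≤⌊⌋ : r ≤ ⌊ m /2⌋
  r≤⌊⌋ = ≤-pred (≤-trans r<⌈⌉ (⌊n/2⌋-mono (n≤1+n (suc m))))

-- Pays for the single extra colour of a one-vertex remainder. The induction starts from `8 ≤ 9`.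
2^[1+n]≤3^n : ∀ {n} → 2 ≤ n → 2 ^ suc n ≤ 3 ^ n
2^[1+n]≤3^n {1}                 (s≤s ())
2^[1+n]≤3^n {2}                 _ = n≤1+n 8
2^[1+n]≤3^n {suc (suc (suc n))} _ =
  *-mono-≤ {2} {3} (n≤1+n 2) (2^[1+n]≤3^n {suc (suc n)} (s≤s (s≤s z≤n)))

-- Large subgraphs of low degree.

module _ {n : ℕ} (G : Graph n) where

  ∈-neighbours : ∀ {x y} → Adj G x y → y ∈ neighbours G x
  ∈-neighbours {x} {y} a = lookup⇒[]= y _
    (trans (lookup∘tabulate _ y) (dec-true (adj? G x y) a))

  deg≤δ : ∀ {S x} → x ∈ S → deg G S x ≤ δ G S
  deg≤δ {S} {x} x∈S = All.lookup (xs≤max 0 (map (deg G S) (filter (_∈? S) (allFin n))))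
    (∈-map⁺ (deg G S) (∈-filter⁺ (_∈? S) (∈-allFin x) x∈S))

  subdim-attained : ∀ {S} → Nonempty S → ∃ λ T → LargeIn G S T × δ G T ≡ subdim G S
  subdim-attained {S} (x , x∈S)
    with argmin-sel id (δ G S) (map (δ G) (filter (largeIn? G S) (allSubsets n)))
  -- The minimum falls on its default `δ G S`; as `S` is nonempty, it is a majority of itself.
  ... | inj₁ e = S , (id , majority (x∈p⇒0<∣p∣ x∈S)) , sym e
    where
    majority : ∀ {m} → 0 < m → ⌊ m /2⌋ + 1 ≤ m
    majority {suc m} _ = ≤-trans (≤-reflexive (+-comm _ 1)) (⌊n/2⌋<n m)
  ... | inj₂ i with ∈-map⁻ (δ G) i
  ... | T , T∈ , e = T , proj₂ (∈-filter⁻ (largeIn? G S) {xs = allSubsets n} T∈) , sym e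

  subdim≤dim : ∀ {S} → Nonempty S → subdim G S ≤ dim G
  subdim≤dim {S} ne = All.lookup (xs≤max 0 (map (subdim G) (filter nonempty? (allSubsets n))))
    (∈-map⁺ (subdim G) (∈-filter⁺ nonempty? (∈-allSubsets S) ne))

  large-low-degree : ∀ {S} → Nonempty S → ∃ λ T → LargeIn G S T × δ G T ≤ dim G
  large-low-degree ne =
    let (T , large , e) = subdim-attained ne
    in T , large , ≤-trans (≤-reflexive e) (subdim≤dim ne)

  -- A majority of the two endpoints has at least `⌊ 2 /2⌋ + 1 = 2` elements, so it contains both of
  -- them and `y` counts towards the degree of `x`.
  edge⇒1≤dim : ∀ {x y} → Adj G x y → 1 ≤ dim G
  edge⇒1≤dim {x} {y} a with large-low-degree {⁅ x ⁆ ∪ ⁅ y ⁆} (x , p⊆p∪q _ (x∈⁅x⁆ x))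
  ... | T , (T⊆S , large) , δ≤ =
    ≤-trans (x∈p⇒0<∣p∣ (x∈p∩q⁺ (∈-neighbours a , y∈T))) (≤-trans (deg≤δ x∈T) δ≤)
    where
    2≤∣T∣ : 2 ≤ ∣ T ∣
    2≤∣T∣ = ≤-trans (+-monoˡ-≤ 1 (⌊n/2⌋-mono (x≢y⇒2≤∣p∣ (p⊆p∪q ⁅ y ⁆ (x∈⁅x⁆ x)) (q⊆p∪q ⁅ x ⁆ _ (x∈⁅x⁆ y))
      λ { refl → irrefl G a }))) large
    not-singleton : ∀ z → T ⊆ ⁅ z ⁆ → 1 < 1
    not-singleton z T⊆ = ≤-trans 2≤∣T∣ (≤-trans (p⊆q⇒∣p∣≤∣q∣ T⊆) (≤-reflexive (∣⁅x⁆∣≡1 z)))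
    x∈T : x ∈ T
    x∈T with x ∈? T
    ... | yes h = h
    ... | no  h = contradiction (not-singleton y only-y) (<-irrefl refl)
      where
      only-y : T ⊆ ⁅ y ⁆
      only-y z∈T with x∈p∪q⁻ ⁅ x ⁆ ⁅ y ⁆ (T⊆S z∈T)
      ... | inj₁ z∈x = contradiction (subst (_∈ T) (x∈⁅y⁆⇒x≡y x z∈x) z∈T) h
      ... | inj₂ z∈y = z∈y
    y∈T : y ∈ T
    y∈T with y ∈? T
    ... | yes h = h
    ... | no  h = contradiction (not-singleton x only-x) (<-irrefl refl)
      where
      only-x : T ⊆ ⁅ x ⁆
      only-x z∈T with x∈p∪q⁻ ⁅ x ⁆ ⁅ y ⁆ (T⊆S z∈T)
      ... | inj₁ z∈x = z∈x
      ... | inj₂ z∈y = contradiction (subst (_∈ T) (x∈⁅y⁆⇒x≡y y z∈y) z∈T) h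

  -- Colourings of vertex subsets.

  χ≤ : ∀ {k} → Colourable G k → χ G ≤ k
  χ≤ {k} col with k <? n
  ... | yes k<n = min≤v⁺ n (filter (colourable? G) (upTo n))
    (inj₂ (lose (∈-filter⁺ (colourable? G) (∈-upTo⁺ k<n) col) ≤-refl))
  -- Outside the searched range, the default `n` of the minimum is already at most `k`.
  ... | no  k≮n = ≤-trans (min≤⊤ n (filter (colourable? G) (upTo n))) (≮⇒≥ k≮n)

  -- ℕ-valued so that the empty set is ColourableOn with 0 colours even when n > 0.
  ColourableOn : Subset n → ℕ → Set
  ColourableOn S k = ∃ λ (c : Fin n → ℕ) →
    (∀ {x} → x ∈ S → c x < k) × (∀ {x y} → x ∈ S → y ∈ S → Adj G x y → c x ≢ c y)

  colourableOn-⊤ : ∀ {k} → ColourableOn ⊤ k → Colourable G k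
  colourableOn-⊤ (c , bound , proper) =
    (λ x → fromℕ< (bound {x} ∈⊤)) ,
    λ x y a e → proper {x} {y} ∈⊤ ∈⊤ a (fromℕ<-injective _ _ (bound {x} ∈⊤) (bound {y} ∈⊤) e)

  -- The count is `∣ S ∣` and not 1 because an empty remainder must cost nothing:
  -- `2 ^ (1 + D) ≤ M ^ D` fails at `M = 2`.
  colourableOn-small : ∀ {S} → ∣ S ∣ ≤ 1 → ColourableOn S ∣ S ∣
  colourableOn-small ∣S∣≤1 = (λ _ → 0) , x∈p⇒0<∣p∣ ,
    λ x∈S y∈S a _ → contradiction ∣S∣≤1 (<⇒≱ (x≢y⇒2≤∣p∣ x∈S y∈S λ { refl → irrefl G a }))

  colourableOn-split : ∀ {S T k l} → ColourableOn T k → ColourableOn (S ─ T) l → ColourableOn S (k + l)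
  colourableOn-split {S} {T} {k} {l} (c , c< , c-proper) (d , d< , d-proper) = e , e< , e-proper
    where
    e : Fin n → ℕ
    e x with x ∈? T
    ... | yes _ = c x
    -- The shift by `k` keeps the two palettes disjoint.
    ... | no  _ = k + d x
    e< : ∀ {x} → x ∈ S → e x < k + l
    e< {x} x∈S with x ∈? T
    ... | yes x∈T = <-≤-trans (c< x∈T) (m≤m+n k l)
    ... | no  x∉T = +-monoʳ-< k (d< (x∈p∧x∉q⇒x∈p─q x∈S x∉T))
    e-proper : ∀ {x y} → x ∈ S → y ∈ S → Adj G x y → e x ≢ e y
    e-proper {x} {y} x∈S y∈S a with x ∈? T | y ∈? T
    ... | yes x∈T | yes y∈T = c-proper x∈T y∈T a
    ... | yes x∈T | no  _   = <⇒≢ (<-≤-trans (c< x∈T) (m≤m+n k _))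
    ... | no  _   | yes y∈T = ≢-sym (<⇒≢ (<-≤-trans (c< y∈T) (m≤m+n k _)))
    ... | no  x∉T | no  y∉T = λ eq →
      d-proper (x∈p∧x∉q⇒x∈p─q x∈S x∉T) (x∈p∧x∉q⇒x∈p─q y∈S y∉T) a (+-cancelˡ-≡ k _ _ eq)

  module Greedy {T : Subset n} {d : ℕ} (deg≤d : ∀ {x} → x ∈ T → deg G T x ≤ d) where

    -- The colouring is total but constrained only on listed vertices of `T`. A new vertex of `T`
    -- has at most `d` neighbours in `T`, listed or not, so one of the `suc d` colours avoids them
    -- all.
    greedy : ∀ xs → ∃ λ (c : Fin n → Fin (suc d)) →
      ∀ {x y} → x ∈ₗ xs → y ∈ₗ xs → x ∈ T → y ∈ T → Adj G x y → c x ≢ c y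
    greedy [] = (λ _ → zero) , λ ()
    greedy (v ∷ vs) with greedy vs | v ∈? T
    ... | c , c-proper | no v∉T = c , proper
      where
      proper : ∀ {x y} → x ∈ₗ v ∷ vs → y ∈ₗ v ∷ vs → x ∈ T → y ∈ T → Adj G x y → c x ≢ c y
      proper (here refl) _           x∈T _   = contradiction x∈T v∉T
      proper (there _)   (here refl) _   y∈T = contradiction y∈T v∉T
      proper (there i)   (there j)           = c-proper i j
    ... | c , c-proper | yes v∈T with avoid-image c (neighbours G v ∩ T) (s≤s (deg≤d v∈T))
    ... | j , fresh = c′ , proper
      where
      c′ : Fin n → Fin (suc d)
      c′ x with x ≟ᶠ v
      ... | yes _ = j
      ... | no  _ = c x
      strip : ∀ {x} → x ≢ v → x ∈ₗ v ∷ vs → x ∈ₗ vs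
      strip x≢v (here x≡v) = contradiction x≡v x≢v
      strip x≢v (there i)  = i
      proper : ∀ {x y} → x ∈ₗ v ∷ vs → y ∈ₗ v ∷ vs → x ∈ T → y ∈ T → Adj G x y → c′ x ≢ c′ y
      proper {x} {y} i i′ x∈T y∈T a with x ≟ᶠ v | y ≟ᶠ v
      ... | yes refl | yes refl = λ _ → irrefl G a
      ... | yes refl | no  _    = ≢-sym (fresh (x∈p∩q⁺ (∈-neighbours a , y∈T)))
      ... | no  _    | yes refl = fresh (x∈p∩q⁺ (∈-neighbours (symmetric G a) , x∈T))
      ... | no  x≢v  | no  y≢v  = c-proper (strip x≢v i) (strip y≢v i′) x∈T y∈T a

    colourableOn-greedy : ColourableOn T (suc d)
    colourableOn-greedy =
      let (c , proper) = greedy (allFin n)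
      in toℕ ∘ c , (λ {x} _ → toℕ<n (c x)) ,
         λ {x} {y} x∈T y∈T a e → proper (∈-allFin x) (∈-allFin y) x∈T y∈T a (toℕ-injective e)

  open Greedy using (colourableOn-greedy)

  -- The halving recursion.

  D : ℕ
  D = 1 + dim G

  -- S can be coloured with k colours such that D further colours still fit
  -- under D log₂ M for every M that S can be the remainder of.
  Remainder : Subset n → Set
  Remainder S = ∃ λ k → ColourableOn S k × (∀ {M} → 2 ≤ M → 1 + 2 * ∣ S ∣ ≤ M → 2 ^ (k + D) ≤ M ^ D)

  LogColourable : Subset n → Set
  LogColourable S = ∃ λ k → ColourableOn S k × 2 ^ k ≤ ∣ S ∣ ^ D

  -- Degrees in `T` are at most `dim G`, so `T` takes `D` colours; the bound for `S ─ T`, taken at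
  -- `M = ∣ S ∣`, leaves room for exactly these.
  halve : ∀ {S} → 2 ≤ ∣ S ∣ → (∀ R → ∣ R ∣ < ∣ S ∣ → Remainder R) → LogColourable S
  halve {S} 2≤∣S∣ rec =
    let (T , (T⊆S , large) , δ≤dim) = large-low-degree (0<∣p∣⇒nonempty (≤-trans (n≤1+n 1) 2≤∣S∣))
        2r<∣S∣                      = 2·rest<whole large (q⊆p⇒∣q∣+∣p─q∣≤∣p∣ S T T⊆S)
        (k , col , bound)           = rec (S ─ T) (≤-trans (s≤s (m≤n*m _ 2)) 2r<∣S∣)
    in D + k ,
       colourableOn-split (colourableOn-greedy (λ x∈T → ≤-trans (deg≤δ x∈T) δ≤dim)) col ,
       subst (λ i → 2 ^ i ≤ ∣ S ∣ ^ D) (+-comm k D) (bound 2≤∣S∣ 2r<∣S∣)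

  remainder-small : 2 ≤ D → ∀ {S} → ∣ S ∣ ≤ 1 → Remainder S
  remainder-small 2≤D {S} ∣S∣≤1 = ∣ S ∣ , colourableOn-small ∣S∣≤1 , bound ∣S∣≤1
    where
    bound : ∀ {m} → m ≤ 1 → ∀ {M} → 2 ≤ M → 1 + 2 * m ≤ M → 2 ^ (m + D) ≤ M ^ D
    -- For the empty set `2 ≤ M` is enough; a single vertex forces `3 ≤ M`, which makes room for its
    -- colour.
    bound z≤n       2≤M _   = ^-monoˡ-≤ D 2≤M
    bound (s≤s z≤n) _   3≤M = ≤-trans (2^[1+n]≤3^n 2≤D) (^-monoˡ-≤ D 3≤M)

  -- `D` further colours cost a factor `2 ^ D`, which doubles the base, and `2 * ∣ S ∣ ≤ M`.
  remainder-large : ∀ {S} → LogColourable S → Remainder S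
  remainder-large {S} (k , col , 2^k≤) = k , col , λ {M} _ lt → begin
    2 ^ (k + D)         ≡⟨ ^-distribˡ-+-* 2 k D ⟩
    2 ^ k * 2 ^ D       ≤⟨ *-monoˡ-≤ (2 ^ D) 2^k≤ ⟩
    ∣ S ∣ ^ D * 2 ^ D   ≡⟨ ^-distribʳ-* ∣ S ∣ 2 D ⟨
    (∣ S ∣ * 2) ^ D     ≡⟨ cong (_^ D) (*-comm ∣ S ∣ 2) ⟩
    (2 * ∣ S ∣) ^ D     ≤⟨ ^-monoˡ-≤ D (≤-trans (n≤1+n _) lt) ⟩
    M ^ D               ∎
    where open ≤-Reasoning

  remainder : 2 ≤ D → ∀ S → Remainder S
  remainder 2≤D S = <-rec (λ m → ∀ S → ∣ S ∣ ≡ m → Remainder S) step ∣ S ∣ S refl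
    where
    step : ∀ m → (∀ {r} → r < m → ∀ R → ∣ R ∣ ≡ r → Remainder R) → ∀ S → ∣ S ∣ ≡ m → Remainder S
    step _ rec S refl with ∣ S ∣ ≤? 1
    ... | yes small = remainder-small 2≤D small
    ... | no  large = remainder-large (halve (≰⇒> large) (λ R lt → rec lt R refl))

  2^χ≤n^D : 2 ≤ n → 2 ^ χ G ≤ n ^ D
  2^χ≤n^D 2≤n with 1 ≤? dim G
  ... | yes 1≤dim = ≤-trans (^-monoʳ-≤ 2 (χ≤ (colourableOn-⊤ col))) (subst (λ m → 2 ^ k ≤ m ^ D) (∣⊤∣≡n n) 2^k≤)
    where
    log-colouring : LogColourable ⊤
    log-colouring = halve (≤-trans 2≤n (≤-reflexive (sym (∣⊤∣≡n n)))) (λ R _ → remainder (s≤s 1≤dim) R)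
    k = proj₁ log-colouring
    col = proj₁ (proj₂ log-colouring)
    2^k≤ = proj₂ (proj₂ log-colouring)
  -- Here `G` has no edge, so one colour suffices.
  ... | no  1≰dim = begin
    2 ^ χ G   ≤⟨ ^-monoʳ-≤ 2 (χ≤ {1} ((λ _ → zero) , λ x y a _ → 1≰dim (edge⇒1≤dim a))) ⟩
    2 ^ 1     ≤⟨ ^-monoʳ-≤ 2 {1} {D} (s≤s z≤n) ⟩
    2 ^ D     ≤⟨ ^-monoˡ-≤ D 2≤n ⟩
    n ^ D     ∎
    where open ≤-Reasoning

-- From powers of naturals to real logarithms.

≤·log₂ : ∀ {n k D} .{{_ : NonZero n}} .{{_ : NonZero D}} → 2 ^ k ≤ n ^ D → fromℕ k ≤ℝ D · log₂ n
≤·log₂ {n} {k} {suc d} le q q<k with lhs p <? rhs p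
  where
  open Log₂ n
  p = q ℚ.* (+ 1 ℚ./ suc d)
... | yes lt = lt
-- Otherwise `p`, which is `q / D`, is not in the lower cut of `log₂ n`; since `p < k / D`, `upper`
-- would give `n ^ D < 2 ^ k`.
... | no  ¬lt = contradiction
  (upper p<k/D (≮⇒≥ ¬lt))
  (≤⇒≯ (≤-trans le (≤-reflexive (sym (*-identityʳ _)))))
  where
  open Log₂ n
  p<k/D : q ℚ.* (+ 1 ℚ./ suc d) ℚ.< mkℚᵘ (+ k) d
  p<k/D = ℚP.<-respʳ-≃
    (*≡* (cong₂ ℤ._*_ (ℤP.*-identityʳ (+ k)) (cong (λ m → + suc m) (sym (+-identityʳ d)))))
    (ℚP.*-monoˡ-<-pos (+ 1 ℚ./ suc d) q<k)

-- The lower cut of a maximum is the sum of both lower cuts, and `x` is the left one; matching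
-- `suc _` lets `_·_` unfold.
·-∣∣-upper : ∀ D .{{_ : NonZero D}} x → D · x ≤ℝ D · ∣ x ∣ℝ
·-∣∣-upper (suc _) x q = inj₁

theorem3p4 : (n : ℕ) .{{_ : NonZero n}} → n ≢ 1 → (G : Graph n) → fromℕ (χ G) ≤ℝ (1 + dim G) · ∣ log₂ n ∣ℝ
-- On one vertex the logarithm is 0 while `χ G` is 1.
theorem3p4 (suc zero) n≢1 G = contradiction refl n≢1
theorem3p4 n@(suc (suc _)) n≢1 G q q<χ =
  ·-∣∣-upper (1 + dim G) (log₂ n) q (≤·log₂ {n} {χ G} (2^χ≤n^D G (s≤s (s≤s z≤n))) q q<χ)
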